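{- Let $G_0$ be a bipartite PMH-graph of order $2n$ with bipartition $U=\{u_i : i\in\{1,\dots,n\}\}$ and $V=\{v_i : i\in\{1,\dots,n\}\}$, for some $n>1$. Let $\mathcal{I}\subseteq\{i : \deg(v_i)=3\}$. For each $i\in\mathcal{I}$, let $G_i$ be a graph (not necessarily bipartite) admitting a 3-malleable vertex $z_i$. Then the graph $G$ obtained by applying a star product on $v_i$ and $z_i$, for each $i\in\mathcal{I}$, is PMH.
   Context: Graphs are finite and connected, may have multiple (parallel) edges, and have no loops; the degree $\deg(v)$ of a vertex $v$ is the number of edges incident to it. A perfect matching is the edge set of a $1$-regular spanning subgraph, and a Hamiltonian cycle is a connected $2$-regular spanning subgraph. A Hamiltonian cycle $H$ extends a perfect matching $M$ if $M\subseteq E(H)$. A graph admitting a perfect matching is PMH if each of its perfect matchings can be extended to a Hamiltonian cycle. For a vertex $v$, $\partial v$ denotes the set of edges incident to $v$. If $G$ admits a perfect matching and $v$ is a vertex of degree $t\ge 2$, then $v$ is $t$-malleable if for every perfect matching $M$ of $G$ there exist Hamiltonian cycles $H_1,\dots,H_{t-1}$ of $G$, all extending $M$, such that $\partial v - M\subset \bigcup_{i=1}^{t-1}E(H_i)$. Star product: let $v\in V(G)$, $z\in V(G')$ be vertices of degree 3 in vertex-disjoint graphs, with incident edges $va_1,va_2,va_3$ and $zb_1,zb_2,zb_3$ respectively. A star product on $v$ and $z$ is the graph $(G-v)\cup(G'-z)\cup\{a_1b_1,a_2b_2,a_3b_3\}$ (for any choice of the ordering of the neighbours). It is assumed that neither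 $G$ nor $G'$ is the cubic graph on two vertices (three parallel edges). Applying a star product on $v_i$ and $z_i$ for each $i\in\mathcal{I}$ means applying these star products successively, starting from $G_0$, each on the vertex $v_i$ of the current graph and the vertex $z_i$ of $G_i$ (each with any choice of ordering of the neighbours). -}

module Defs where

open import Data.Bool using (Bool; true; T)
open import Data.Bool.Properties using (T?)
open import Data.Fin using (Fin; zero; suc)
import Data.Fin.Properties as Fin
import Data.Fin.Subset as Subset
open import Data.Irrelevant using ([_])
open import Data.Nat using (ℕ; zero; suc; _+_; _∸_; _≤_)
open import Data.Product using (Σ; ∃; ∃₂; ∃-syntax; _×_; _,_; proj₁; proj₂)
open import Data.Refinement using (Refinement; Refinement-syntax; _,_; value; value-injective)
open import Data.Sum using (_⊎_; inj₁; inj₂)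
open import Data.Sum.Function.Propositional using (_⊎-↔_)
open import Data.Sum.Properties using (inj₁-injective; inj₂-injective)
open import Function using (_∘_; _↔_; _↣_; Inverse; Injection; mk↔ₛ′; mk↣)
open import Function.Construct.Composition using (_↔-∘_; _↣-∘_)
open import Function.Construct.Identity using (↔-id)
open import Function.Construct.Symmetry using (↔-sym)
open import Function.Properties.Inverse using (↔⇒↣)
open import Level using (0ℓ)
open import Relation.Binary.Construct.Closure.ReflexiveTransitive using (Star)
open import Relation.Binary.Definitions using (DecidableEquality)
open import Relation.Binary.PropositionalEquality
open import Relation.Nullary using (Dec; yes; no; ¬_; ¬?; contradiction-irr)
open import Relation.Nullary.Decidable using (via-injection; _×-dec_; _⊎-dec_)
open import Relation.Unary using (Pred; Decidable)

------------------------------------------------------------------------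
-- Finite types

record Finite (A : Set) : Set where
  field
    size        : ℕ
    enumeration : A ↔ Fin size

  infix 4 _≟_
  _≟_ : DecidableEquality A
  _≟_ = via-injection (↔⇒↣ enumeration) Fin._≟_

open Finite using (size; enumeration)

finite-Fin : ∀ n → Finite (Fin n)
finite-Fin n = record { size = n ; enumeration = ↔-id (Fin n) }

finite-⊎ : {A B : Set} → Finite A → Finite B → Finite (A ⊎ B)
finite-⊎ fa fb = record
  { size        = size fa + size fb
  ; enumeration = ↔-sym Fin.+↔⊎ ↔-∘ (enumeration fa ⊎-↔ enumeration fb)
  }

-- The library's refinement type [ a ∈ A ∣ P a ] carries an irrelevant
-- proof of P a, so its elements are exactly the elements of A satisfying P.

private
  countFin : ∀ {n} {P : Pred (Fin n) 0ℓ} → Decidable P →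
             Finite [ i ∈ Fin n ∣ P i ]
  countFin {zero} P? = record
    { size        = 0
    ; enumeration = mk↔ₛ′ (λ { (() , _) }) (λ ()) (λ ()) (λ { (() , _) })
    }
  countFin {suc n} {P} P? with P? zero | countFin {n} {P ∘ suc} (P? ∘ suc)
  ... | yes p | record { size = k ; enumeration = f } = record
    { size = suc k
    ; enumeration = mk↔ₛ′ to from
        (λ { zero → refl ; (suc j) → cong suc (F.strictlyInverseˡ j) })
        (λ { (zero , _) → refl
           ; (suc i , q) → cong up (F.strictlyInverseʳ (i , q)) })
    }
    where
    module F = Inverse f
    up : [ i ∈ Fin n ∣ P (suc i) ] → [ i ∈ Fin (suc n) ∣ P i ]
    up (i , q) = suc i , q
    to : [ i ∈ Fin (suc n) ∣ P i ] → Fin (suc k)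
    to (zero  , _) = zero
    to (suc i , q) = suc (F.to (i , q))
    from : Fin (suc k) → [ i ∈ Fin (suc n) ∣ P i ]
    from zero    = zero , [ p ]
    from (suc j) = up (F.from j)
  ... | no ¬p | record { size = k ; enumeration = f } = record
    { size = k
    ; enumeration = mk↔ₛ′ to (up ∘ F.from) F.strictlyInverseˡ
        (λ { (zero , [ q ]) → contradiction-irr q ¬p
           ; (suc i , q) → cong up (F.strictlyInverseʳ (i , q)) })
    }
    where
    module F = Inverse f
    up : [ i ∈ Fin n ∣ P (suc i) ] → [ i ∈ Fin (suc n) ∣ P i ]
    up (i , q) = suc i , q
    to : [ i ∈ Fin (suc n) ∣ P i ] → Fin k
    to (zero  , [ q ]) = contradiction-irr q ¬p
    to (suc i , q)     = F.to (i , q)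

finite-refinement : {A : Set} → Finite A → {P : Pred A 0ℓ} → Decidable P →
                    Finite [ a ∈ A ∣ P a ]
finite-refinement {A} fa {P} P? = record
  { size        = size counted
  ; enumeration = enumeration counted ↔-∘ transport
  }
  where
  module A = Inverse (enumeration fa)
  counted : Finite [ i ∈ Fin (size fa) ∣ P (A.from i) ]
  counted = countFin (P? ∘ A.from)
  transport : [ a ∈ A ∣ P a ] ↔ [ i ∈ Fin (size fa) ∣ P (A.from i) ]
  transport = mk↔ₛ′
    (λ { (a , [ p ]) → A.to a , [ subst P (sym (A.strictlyInverseʳ a)) p ] })
    (λ { (i , p) → A.from i , p })
    (λ { (i , _) → value-injective (A.strictlyInverseˡ i) })
    (λ { (a , _) → value-injective (A.strictlyInverseʳ a) })

------------------------------------------------------------------------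
-- Loopless finite multigraphs; connectedness is the separate predicate
-- Connected below.

record Multigraph : Set₁ where
  field
    V E      : Set
    finite-V : Finite V
    finite-E : Finite E
    -- The order of the two ends of an edge carries no meaning.
    ends     : E → V × V
    loopless : ∀ e → proj₁ (ends e) ≢ proj₂ (ends e)

  order : ℕ
  order = size finite-V

  infix 4 _≟ⱽ_
  _≟ⱽ_ : DecidableEquality V
  _≟ⱽ_ = Finite._≟_ finite-V

  Joins : E → V → V → Set
  Joins e u w = ends e ≡ (u , w) ⊎ ends e ≡ (w , u)

  Incident : E → V → Set
  Incident e w = proj₁ (ends e) ≡ w ⊎ proj₂ (ends e) ≡ w

  incident? : ∀ e w → Dec (Incident e w)
  incident? e w = (proj₁ (ends e) ≟ⱽ w) ⊎-dec (proj₂ (ends e) ≟ⱽ w)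

  ∂ : V → Set
  ∂ w = [ e ∈ E ∣ Incident e w ]

  -- The end of e other than w, for an edge e incident to w.
  otherEnd : E → V → V
  otherEnd e w with proj₁ (ends e) ≟ⱽ w
  ... | yes _ = proj₂ (ends e)
  ... | no  _ = proj₁ (ends e)

  otherEnd-≢ : ∀ e w → otherEnd e w ≢ w
  otherEnd-≢ e w with proj₁ (ends e) ≟ⱽ w
  ... | yes p = λ q → loopless e (trans p (sym q))
  ... | no ¬p = ¬p

  -- A set of edges, identified with the spanning subgraph it forms.
  EdgeSet : Set
  EdgeSet = E → Bool

  infix 4 _∈_ _∉_ _⊆_
  _∈_ _∉_ : E → EdgeSet → Set
  e ∈ F = T (F e)
  e ∉ F = ¬ (e ∈ F)

  _⊆_ : EdgeSet → EdgeSet → Set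
  F ⊆ F′ = ∀ e → e ∈ F → e ∈ F′

  allEdges : EdgeSet
  allEdges _ = true

  degreeIn : EdgeSet → V → ℕ
  degreeIn F w =
    size (finite-refinement finite-E (λ e → T? (F e) ×-dec incident? e w))

  deg : V → ℕ
  deg = degreeIn allEdges

  Regular : ℕ → EdgeSet → Set
  Regular d F = ∀ w → degreeIn F w ≡ d

  Adjacent : EdgeSet → V → V → Set
  Adjacent F u w = ∃[ e ] (e ∈ F × Joins e u w)

  ConnectedSpanning : EdgeSet → Set
  ConnectedSpanning F = ∀ u w → Star (Adjacent F) u w

  PerfectMatching : EdgeSet → Set
  PerfectMatching M = Regular 1 M

  HamiltonianCycle : EdgeSet → Set
  HamiltonianCycle H = Regular 2 H × ConnectedSpanning H

  HasPerfectMatching : Set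
  HasPerfectMatching = ∃[ M ] PerfectMatching M

open Multigraph using (V; E; order; deg; ∂; Incident; incident?; otherEnd)

Connected : Multigraph → Set
Connected G = ConnectedSpanning allEdges
  where open Multigraph G

PMH : Multigraph → Set
PMH G = HasPerfectMatching ×
        (∀ M → PerfectMatching M → ∃[ H ] (HamiltonianCycle H × M ⊆ H))
  where open Multigraph G

Malleable : (G : Multigraph) → V G → ℕ → Set
Malleable G v t =
  deg G v ≡ t × 2 ≤ t × HasPerfectMatching ×
  (∀ M → PerfectMatching M →
     Σ (Fin (t ∸ 1) → EdgeSet) λ H →
       (∀ i → HamiltonianCycle (H i) × M ⊆ H i) ×
       (∀ e → Incident G e v → e ∉ M → ∃[ i ] (e ∈ H i)))
  where open Multigraph G using (HasPerfectMatching; PerfectMatching;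
                                 HamiltonianCycle; EdgeSet; _⊆_; _∈_; _∉_)

-- The cubic graph on two vertices (three parallel edges).
IsTheta : Multigraph → Set
IsTheta G = order G ≡ 2 × (∀ w → deg G w ≡ 3)

-- A bipartition with classes {u i} and {v i}, both indexed by Fin n.
record Bipartition (G : Multigraph) (n : ℕ) : Set where
  field
    classes : (Fin n ⊎ Fin n) ↔ V G

  u : Fin n → V G
  u i = Inverse.to classes (inj₁ i)

  v : Fin n → V G
  v i = Inverse.to classes (inj₂ i)

  field
    bipartite : ∀ e → ∃₂ λ i j → Multigraph.Joins G e (u i) (v j)

  v↣ : Fin n ↣ V G
  v↣ = mk↣ {to = v} (inj₂-injective ∘ Injection.injective (↔⇒↣ classes))

------------------------------------------------------------------------
-- Star products

-- A labelling by Fin 3 of the edges at w, which in particular has degree 3.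
Ordering : (G : Multigraph) → V G → Set
Ordering G w = Fin 3 ↔ ∂ G w

module _ (G : Multigraph) {v : V G} (α : Ordering G v)
         (G′ : Multigraph) {z : V G′} (β : Ordering G′ z) where

  private
    module G  = Multigraph G
    module G′ = Multigraph G′

  V⋆ E⋆ : Set
  V⋆ = [ w ∈ G.V ∣ w ≢ v ] ⊎ [ w ∈ G′.V ∣ w ≢ z ]
  E⋆ = [ e ∈ G.E ∣ ¬ G.Incident e v ] ⊎
       [ e ∈ G′.E ∣ ¬ G′.Incident e z ] ⊎
       Fin 3

  a⋆ : Fin 3 → [ w ∈ G.V ∣ w ≢ v ]
  a⋆ i = otherEnd G e v , [ G.otherEnd-≢ e v ]
    where e = value (Inverse.to α i)

  b⋆ : Fin 3 → [ w ∈ G′.V ∣ w ≢ z ]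
  b⋆ i = otherEnd G′ e z , [ G′.otherEnd-≢ e z ]
    where e = value (Inverse.to β i)

  ends⋆ : E⋆ → V⋆ × V⋆
  ends⋆ (inj₁ (e , [ p ])) =
    inj₁ (proj₁ (G.ends e) , [ (λ q → p (inj₁ q)) ]) ,
    inj₁ (proj₂ (G.ends e) , [ (λ q → p (inj₂ q)) ])
  ends⋆ (inj₂ (inj₁ (e , [ p ]))) =
    inj₂ (proj₁ (G′.ends e) , [ (λ q → p (inj₁ q)) ]) ,
    inj₂ (proj₂ (G′.ends e) , [ (λ q → p (inj₂ q)) ])
  ends⋆ (inj₂ (inj₂ i)) = inj₁ (a⋆ i) , inj₂ (b⋆ i)

  loopless⋆ : ∀ e → proj₁ (ends⋆ e) ≢ proj₂ (ends⋆ e)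
  loopless⋆ (inj₁ (e , [ _ ])) q =
    G.loopless e (cong value (inj₁-injective q))
  loopless⋆ (inj₂ (inj₁ (e , [ _ ]))) q =
    G′.loopless e (cong value (inj₂-injective q))
  loopless⋆ (inj₂ (inj₂ i)) ()

  -- (G − v) ∪ (G′ − z) ∪ {a₁b₁, a₂b₂, a₃b₃}
  starProduct : Multigraph
  starProduct = record
    { V        = V⋆
    ; E        = E⋆
    ; finite-V = finite-⊎
        (finite-refinement G.finite-V (λ w → ¬? (w G.≟ⱽ v)))
        (finite-refinement G′.finite-V (λ w → ¬? (w G′.≟ⱽ z)))
    ; finite-E = finite-⊎
        (finite-refinement G.finite-E (λ e → ¬? (G.incident? e v)))
        (finite-⊎
          (finite-refinement G′.finite-E (λ e → ¬? (G′.incident? e z)))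
          (finite-Fin 3))
    ; ends     = ends⋆
    ; loopless = loopless⋆
    }

  -- The vertices of G still to be treated after the star product on the first.
  remaining : ∀ {k} (w : Fin (suc k) ↣ G.V) → Injection.to w zero ≡ v →
              Fin k ↣ V starProduct
  remaining w w₀≡v = mk↣ {to = to} inj
    where
    module w = Injection w
    to : Fin _ → V starProduct
    to j = inj₁ (w.to (suc j) ,
                 [ (λ q → Fin.0≢1+n (w.injective (trans w₀≡v (sym q)))) ])
    inj : ∀ {i j} → to i ≡ to j → i ≡ j
    inj = Fin.suc-injective ∘ w.injective ∘ cong value ∘ inj₁-injective

-- StarProducts K v G z H: H is obtained from K by successively applying, for
-- j = 0, 1, …, a star product on the vertex v j of the current graph and z j
-- of G j.  The vertices v j still to be treated persist in each star product,
-- and every step may use any ordering of the neighbours.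
data StarProducts : ∀ {k} (K : Multigraph) → Fin k ↣ V K →
                    (G : Fin k → Multigraph) → (∀ j → V (G j)) →
                    Multigraph → Set₁ where
  done : ∀ {K} {v : Fin 0 ↣ V K} {G : Fin 0 → Multigraph} {z : ∀ j → V (G j)} →
         StarProducts K v G z K
  step : ∀ {k K H} {v : Fin (suc k) ↣ V K} {G : Fin (suc k) → Multigraph}
           {z : ∀ j → V (G j)}
         (α : Ordering K (Injection.to v zero))
         (β : Ordering (G zero) (z zero)) →
         StarProducts (starProduct K α (G zero) β)
                      (remaining K α (G zero) β v refl)
                      (G ∘ suc) (λ j → z (suc j)) H →
         StarProducts K v G z H

-- The elements of a subset of Fin n, as a type.
Element : ∀ {n} → Subset.Subset n → Set
Element {n} S = [ i ∈ Fin n ∣ i Subset.∈ S ]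

value↣ : ∀ {n} {S : Subset.Subset n} → Element S ↣ Fin n
value↣ = mk↣ value-injective

-- The v i with i ∈ S, listed in the order given by an enumeration of S.
listed : ∀ {G n k} (B : Bipartition G n) {S : Subset.Subset n} →
         Fin k ↔ Element S → Fin k ↣ V G
listed B enum = Bipartition.v↣ B ↣-∘ (value↣ ↣-∘ ↔⇒↣ enum)

{-# OPTIONS --safe #-}
module Submission where

-- Contracting each G_i − z_i back to v_i turns a perfect matching M of G into
-- an edge set of G₀ with one edge at every u_i, and, since G_i has even order,
-- at least one edge at every v_i.  As the two classes of G₀ have equal size, it
-- is a perfect matching of G₀, and M also restricts to a perfect matching of
-- each G_i.  A Hamiltonian cycle H₀ of G₀ extending the former uses exactly one
-- more edge at v_i; malleability supplies a Hamiltonian cycle of G_i extending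
-- the latter through the corresponding edge at z_i, and it is glued to H₀.
--
-- Intermediate graphs need not be bipartite, so the induction over the star
-- products carries the consequence Tight of bipartiteness instead.

open import Defs
open import Data.Bool using (T; true; false; not; _∧_; _∨_)
open import Data.Bool.Properties using (T?; T-∧)
open import Data.Empty using (⊥; ⊥-elim)
open import Data.Fin using (Fin; zero; suc; toℕ)
open import Data.Fin.Permutation using (↔⇒≡)
import Data.Fin.Properties as Fin
open import Data.Fin.Subset using (Subset)
open import Data.Irrelevant using ([_])
open import Data.Nat using (ℕ; suc; _+_; _*_; _<_)
open import Data.Nat.GeneralisedArithmetic using (fold)
import Data.Nat.Properties as ℕ
open import Data.Product using (∃; _×_; _,_; proj₁; proj₂)
open import Data.Refinement using (Refinement-syntax; _,_; value; value-injective)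
open import Data.Sum as Sum using (_⊎_; inj₁; inj₂)
open import Data.Sum.Properties using (inj₁-injective; inj₂-injective)
open import Data.Unit using (tt)
open import Function using (_↔_; _↣_; _∘_; Inverse; Injection; Equivalence; mk↔ₛ′)
open import Function.Construct.Composition using (_↔-∘_)
open import Function.Construct.Symmetry using (↔-sym)
open import Function.Definitions using (Injective)
open import Function.Properties.Inverse using (↔⇒↣)
open import Level using (0ℓ)
open import Relation.Binary.Construct.Closure.ReflexiveTransitive as Star
  using (Star; ε; _◅_; _◅◅_; return; reverse)
open import Relation.Binary.PropositionalEquality
open import Relation.Nullary using (Dec; yes; no; ¬_; ¬?; contradiction)
open import Relation.Nullary.Decidable using (recompute; decidable-stable; _×-dec_)
open import Relation.Unary using (Pred; Decidable)

open Finite using (size; enumeration)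

-- Membership in edge sets, read off booleans

T-injective : ∀ {x y} → (T x → T y) → (T y → T x) → x ≡ y
T-injective {false} {false} _ _ = refl
T-injective {false} {true}  _ g = ⊥-elim (g tt)
T-injective {true}  {false} f _ = ⊥-elim (f tt)
T-injective {true}  {true}  _ _ = refl

T-not : ∀ {x} → T x → ¬ T (not x)
T-not {true} _ ()

∖-intro : ∀ {x y} → T x → ¬ T y → T (x ∧ not y)
∖-intro {true} {false} _ _  = tt
∖-intro {true} {true}  _ ¬y = ¬y tt

∨-∖ : ∀ {x y} → (T x → T y) → y ≡ x ∨ (y ∧ not x)
∨-∖ {false} {false} _ = refl
∨-∖ {false} {true}  _ = refl
∨-∖ {true}  {false} f = ⊥-elim (f tt)
∨-∖ {true}  {true}  _ = refl

-- Sizes of finite types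

size-cong : {A B : Set} (fa : Finite A) (fb : Finite B) → A ↔ B →
            size fa ≡ size fb
size-cong fa fb A↔B =
  ↔⇒≡ (enumeration fb ↔-∘ (A↔B ↔-∘ ↔-sym (enumeration fa)))

fin1-contractible : (i : Fin 1) → i ≡ zero
fin1-contractible zero = refl

size≡1⇒contractible : {A : Set} (fa : Finite A) → size fa ≡ 1 →
                      ∃ λ a → ∀ b → b ≡ a
size≡1⇒contractible {A} fa size≡1 = F.from zero ,
  λ b → trans (sym (F.strictlyInverseʳ b))
              (cong F.from (fin1-contractible (F.to b)))
  where
  module F = Inverse (subst (λ n → A ↔ Fin n) size≡1 (enumeration fa))

contractible⇒size≡1 : {A : Set} (fa : Finite A) → (∃ λ a → ∀ b → b ≡ a) →
                      size fa ≡ 1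
contractible⇒size≡1 fa (a , a-unique) = size-cong fa (finite-Fin 1)
  (mk↔ₛ′ (λ _ → zero) (λ _ → a) (λ i → sym (fin1-contractible i))
         (λ b → sym (a-unique b)))

-- For comparing degrees along an edge map that need not be onto: `f` only has to hit what satisfies
-- `Q`. Decidability of `Q` recovers a relevant proof by `recompute`, so that a preimage can be
-- chosen.
size-refinement-↔ :
  {A B : Set} (fa : Finite A) (fb : Finite B)
  {P : Pred A 0ℓ} {Q : Pred B 0ℓ} (P? : Decidable P) (Q? : Decidable Q)
  (f : A → B) → Injective _≡_ _≡_ f →
  (∀ {a} → P a → Q (f a)) → (∀ {b} → Q b → ∃ λ a → f a ≡ b × P a) →
  size (finite-refinement fa P?) ≡ size (finite-refinement fb Q?)
size-refinement-↔ {A} {B} fa fb {P} {Q} P? Q? f f-injective P⇒Q Q⇒P =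
  size-cong (finite-refinement fa P?) (finite-refinement fb Q?)
    (mk↔ₛ′ to from
      (λ { (b , [ q ]) → value-injective (f∘pre b q) })
      (λ { (a , [ p ]) → value-injective (f-injective (f∘pre (f a) (P⇒Q p))) }))
  where
  preimage : ∀ b → .(Q b) → ∃ λ a → f a ≡ b × P a
  preimage b q = Q⇒P (recompute (Q? b) q)
  f∘pre : ∀ b .(q : Q b) → f (proj₁ (preimage b q)) ≡ b
  f∘pre b q = proj₁ (proj₂ (preimage b q))
  to : [ a ∈ A ∣ P a ] → [ b ∈ B ∣ Q b ]
  to (a , [ p ]) = f a , [ P⇒Q p ]
  from : [ b ∈ B ∣ Q b ] → [ a ∈ A ∣ P a ]
  from (b , [ q ]) = proj₁ (preimage b q) , [ proj₂ (proj₂ (preimage b q)) ]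

size-refinement-⊎ :
  {A : Set} (fa : Finite A) {P Q R : Pred A 0ℓ}
  (P? : Decidable P) (Q? : Decidable Q) (R? : Decidable R) →
  (∀ {a} → P a → Q a ⊎ R a) → (∀ {a} → Q a → P a) → (∀ {a} → R a → P a) →
  (∀ {a} → Q a → R a → ⊥) →
  size (finite-refinement fa P?) ≡
  size (finite-refinement fa Q?) + size (finite-refinement fa R?)
size-refinement-⊎ {A} fa {P} {Q} {R} P? Q? R? P⇒Q⊎R Q⇒P R⇒P disjoint =
  size-cong (finite-refinement fa P?)
    (finite-⊎ (finite-refinement fa Q?) (finite-refinement fa R?))
    (mk↔ₛ′ to from to∘from from∘to)
  where
  tag : ∀ {a} → Q a ⊎ R a → [ a ∈ A ∣ Q a ] ⊎ [ a ∈ A ∣ R a ]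
  tag {a} (inj₁ q) = inj₁ (a , [ q ])
  tag {a} (inj₂ r) = inj₂ (a , [ r ])
  -- Which summand `P⇒Q⊎R` returns is not controlled; disjointness excludes the wrong one.
  tag-inj₁ : ∀ {a} .(q : Q a) (s : Q a ⊎ R a) → tag s ≡ inj₁ (a , [ q ])
  tag-inj₁ q (inj₁ _) = refl
  tag-inj₁ q (inj₂ r) = ⊥-elim (disjoint (recompute (Q? _) q) r)
  tag-inj₂ : ∀ {a} .(r : R a) (s : Q a ⊎ R a) → tag s ≡ inj₂ (a , [ r ])
  tag-inj₂ r (inj₁ q) = ⊥-elim (disjoint q (recompute (R? _) r))
  tag-inj₂ r (inj₂ _) = refl
  to : [ a ∈ A ∣ P a ] → [ a ∈ A ∣ Q a ] ⊎ [ a ∈ A ∣ R a ]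
  to (a , [ p ]) = tag (P⇒Q⊎R (recompute (P? a) p))
  from : [ a ∈ A ∣ Q a ] ⊎ [ a ∈ A ∣ R a ] → [ a ∈ A ∣ P a ]
  from (inj₁ (a , [ q ])) = a , [ Q⇒P q ]
  from (inj₂ (a , [ r ])) = a , [ R⇒P r ]
  to∘from : ∀ s → to (from s) ≡ s
  to∘from (inj₁ (a , [ q ])) = tag-inj₁ q _
  to∘from (inj₂ (a , [ r ])) = tag-inj₂ r _
  from-tag : ∀ {a} .(p : P a) (s : Q a ⊎ R a) → from (tag s) ≡ (a , [ p ])
  from-tag p (inj₁ _) = refl
  from-tag p (inj₂ _) = refl
  from∘to : ∀ x → from (to x) ≡ x
  from∘to (a , [ p ]) = from-tag p (P⇒Q⊎R (recompute (P? a) p))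

-- A missed `i` could be added as one more value, giving an injection of `Fin (suc n)` into `Fin n`.
fin-injective⇒surjective : ∀ {n} {f : Fin n → Fin n} → Injective _≡_ _≡_ f →
                           ∀ i → ∃ λ j → f j ≡ i
fin-injective⇒surjective {n} {f} f-injective i =
  decidable-stable (Fin.any? λ j → f j Fin.≟ i) λ missed →
    ℕ.1+n≰n (Fin.injective⇒≤ (extended-injective missed))
  where
  extended : Fin (suc n) → Fin n
  extended zero    = i
  extended (suc j) = f j
  extended-injective : ¬ (∃ λ j → f j ≡ i) → Injective _≡_ _≡_ extended
  extended-injective missed {zero}  {zero}  _  = refl
  extended-injective missed {zero}  {suc k} eq = contradiction (k , sym eq) missed
  extended-injective missed {suc j} {zero}  eq = contradiction (j , eq) missed
  extended-injective missed {suc j} {suc k} eq = cong suc (f-injective eq)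

-- Orbits of two fixed-point-free involutions

fold-shift : {A : Set} (f : A → A) (x : A) (n : ℕ) →
             fold (f x) f n ≡ f (fold x f n)
fold-shift f x ℕ.zero  = refl
fold-shift f x (suc n) = cong f (fold-shift f x n)

fold-injective : {A : Set} {f : A → A} → Injective _≡_ _≡_ f →
                 ∀ m {x y} → fold x f m ≡ fold y f m → x ≡ y
fold-injective f-injective ℕ.zero  eq = eq
fold-injective f-injective (suc m) eq =
  fold-injective f-injective m (f-injective eq)

fold-+ : {A : Set} (f : A → A) (x : A) (m n : ℕ) →
         fold x f (m + n) ≡ fold (fold x f n) f m
fold-+ f x ℕ.zero  n = refl
fold-+ f x (suc m) n = cong f (fold-+ f x m n)

-- By pigeonhole two iterates coincide, and injectivity cancels the steps they share. The return
-- time is positive because the two indices are distinct.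
fold-returns : {A : Set} (fa : Finite A) {f : A → A} → Injective _≡_ _≡_ f →
               ∀ x → ∃ λ m → fold x f (suc m) ≡ x
fold-returns fa {f} f-injective x
  with i , j , i<j , eq ← Fin.pigeonhole (ℕ.n<1+n (size fa))
         (λ i → Inverse.to (enumeration fa) (fold x f (toℕ i)))
  with d , i+1+d≡j ← ℕ.m≤n⇒∃[o]m+o≡n i<j
  = d , fold-injective f-injective (toℕ i) (begin
      fold (fold x f (suc d)) f (toℕ i)  ≡⟨ fold-+ f x (toℕ i) (suc d) ⟨
      fold x f (toℕ i + suc d)           ≡⟨ cong (fold x f) (trans (ℕ.+-suc (toℕ i) d) i+1+d≡j) ⟩
      fold x f (toℕ j)                   ≡⟨ Injection.injective (↔⇒↣ (enumeration fa)) eq ⟨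
      fold x f (toℕ i)                   ∎)
  where open ≡-Reasoning

-- To be used with `σ` and `τ` matching each vertex along `M` and along the rest of a Hamiltonian
-- cycle `H` extending `M`. The aim is that the cycle stays connected when a vertex is deleted.
module Involutions {A : Set} (fa : Finite A) (σ τ : A → A)
  (σσ : ∀ x → σ (σ x) ≡ x) (ττ : ∀ x → τ (τ x) ≡ x)
  (σ-free : ∀ x → σ x ≢ x) (τ-free : ∀ x → τ x ≢ x) where

  private
    _≟_ = Finite._≟_ fa

  ρ : A → A
  ρ x = τ (σ x)

  ρ-injective : Injective _≡_ _≡_ ρ
  ρ-injective {x} {y} eq = begin
    x                  ≡⟨ σσ x ⟨
    σ (σ x)            ≡⟨ cong σ (ττ (σ x)) ⟨
    σ (τ (ρ x))        ≡⟨ cong (σ ∘ τ) eq ⟩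
    σ (τ (ρ y))        ≡⟨ cong σ (ττ (σ y)) ⟩
    σ (σ y)            ≡⟨ σσ y ⟩
    y                  ∎
    where open ≡-Reasoning

  -- These words are palindromes in σ and τ, hence conjugate to σ or τ.
  mutual
    σρⁿ-free : ∀ n x → σ (fold x ρ n) ≢ x
    σρⁿ-free ℕ.zero  x eq = σ-free x eq
    σρⁿ-free (suc n) x eq = ρⁿτ-free n (σ x) (begin
      fold (τ (σ x)) ρ n          ≡⟨ fold-shift ρ x n ⟩
      fold x ρ (suc n)            ≡⟨ σσ _ ⟨
      σ (σ (fold x ρ (suc n)))    ≡⟨ cong σ eq ⟩
      σ x                         ∎)
      where open ≡-Reasoning

    ρⁿτ-free : ∀ n x → fold (τ x) ρ n ≢ x
    ρⁿτ-free ℕ.zero  x eq = τ-free x eq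
    ρⁿτ-free (suc n) x eq = σρⁿ-free n (τ x) (trans (sym (ττ _)) (cong τ eq))

  Step : A → A → Set
  Step x y = y ≡ σ x ⊎ y ≡ τ x

  StepOff : A → A → A → Set
  StepOff v x y = x ≢ v × y ≢ v × Step x y

  stepOff-sym : ∀ {v x y} → StepOff v x y → StepOff v y x
  stepOff-sym {x = x} (x≢v , y≢v , inj₁ refl) = y≢v , x≢v , inj₁ (sym (σσ x))
  stepOff-sym {x = x} (x≢v , y≢v , inj₂ refl) = y≢v , x≢v , inj₂ (sym (ττ x))

  -- Alternate `τ` and `σ` from `σ v`. By `σρⁿ-free` the walk can meet `v` only at some power of
  -- `ρ`, which it does since orbits of `ρ` return; the vertex just before is then `τ v`.
  σv⇝τv : ∀ v → Star (StepOff v) (σ v) (τ v)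
  σv⇝τv v with m , returns ← fold-returns fa ρ-injective v | along-orbit m
    where
    along-orbit : ∀ n → Star (StepOff v) (σ v) (σ (fold v ρ n)) ⊎
                        Star (StepOff v) (σ v) (τ v)
    along-orbit ℕ.zero  = inj₁ ε
    along-orbit (suc n) with along-orbit n
    ... | inj₂ σv⇝τv′ = inj₂ σv⇝τv′
    ... | inj₁ walk with fold v ρ (suc n) ≟ v
    ...   | yes eq = inj₂ (subst (Star _ _) (trans (sym (ττ _)) (cong τ eq)) walk)
    ...   | no neq = inj₁ (walk ◅◅
              (σρⁿ-free n v , neq , inj₂ refl) ◅
              (neq , σρⁿ-free (suc n) v , inj₁ refl) ◅ ε)
  ... | inj₁ walk  = subst (Star _ _) (trans (sym (ττ _)) (cong τ returns)) walk
  ... | inj₂ σv⇝τv′ = σv⇝τv′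

  -- Cut the walk just before its first visit to `v`. It ends at `σ v` or at `τ v`, and from `τ v`
  -- the reverse of `σv⇝τv` leads on to `σ v`.
  connected-off : ∀ {v x} → Star Step x v → x ≢ v → Star (StepOff v) x (σ v)
  connected-off ε x≢v = contradiction refl x≢v
  connected-off {v} {x} (_◅_ {j = y} s rest) x≢v with y ≟ v
  ... | no y≢v = (x≢v , y≢v , s) ◅ connected-off rest y≢v
  ... | yes refl with s
  ...   | inj₁ eq = subst (λ a → Star _ a _) (trans (cong σ eq) (σσ x)) ε
  ...   | inj₂ eq = subst (λ a → Star _ a _) (trans (cong τ eq) (ττ x))
                      (reverse stepOff-sym (σv⇝τv v))

-- Matchings and Hamiltonian cycles

module Edges (G : Multigraph) where

  open Multigraph G

  At : EdgeSet → V → Pred E 0ℓ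
  At F w e = e ∈ F × Incident e w

  at? : ∀ F w → Decidable (At F w)
  at? F w e = T? (F e) ×-dec incident? e w

  Covered : EdgeSet → V → Set
  Covered F w = ∃ (At F w)

  OnlyEdge : EdgeSet → V → E → Set
  OnlyEdge F w e = At F w e × (∀ {e′} → At F w e′ → e′ ≡ e)

  infixl 6 _∖_
  _∖_ : EdgeSet → EdgeSet → EdgeSet
  (F ∖ F′) e = F e ∧ not (F′ e)

  onlyEdge : ∀ F {w} → degreeIn F w ≡ 1 → ∃ (OnlyEdge F w)
  onlyEdge F {w} deg≡1
    with (e , [ p ]) , unique ← size≡1⇒contractible
           (finite-refinement finite-E (at? F w)) deg≡1
    = e , recompute (at? F w e) p , λ {e′} p′ → cong value (unique (e′ , [ p′ ]))

  onlyEdge-at : ∀ F {w e} → degreeIn F w ≡ 1 → At F w e → OnlyEdge F w e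
  onlyEdge-at F {w} {e} deg≡1 p with e₀ , _ , only ← onlyEdge F {w} deg≡1 =
    p , λ p′ → trans (only p′) (sym (only p))

  onlyEdge⇒degree≡1 : ∀ F {w} → ∃ (OnlyEdge F w) → degreeIn F w ≡ 1
  onlyEdge⇒degree≡1 F {w} (e , p , unique) = contractible⇒size≡1
    (finite-refinement finite-E (at? F w))
    ((e , [ p ]) ,
     λ { (e′ , [ p′ ]) → value-injective (unique (recompute (at? F w e′) p′)) })

  joins-sym : ∀ {e x y} → Joins e x y → Joins e y x
  joins-sym (inj₁ eq) = inj₂ eq
  joins-sym (inj₂ eq) = inj₁ eq

  joins⇒incident : ∀ {e x y} → Joins e x y → Incident e x
  joins⇒incident (inj₁ eq) = inj₁ (cong proj₁ eq)
  joins⇒incident (inj₂ eq) = inj₂ (cong proj₂ eq)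

  joins⇒≢ : ∀ {e x y} → Joins e x y → x ≢ y
  joins⇒≢ {e} (inj₁ eq) refl = loopless e (trans (cong proj₁ eq) (sym (cong proj₂ eq)))
  joins⇒≢ {e} (inj₂ eq) refl = loopless e (trans (cong proj₁ eq) (sym (cong proj₂ eq)))

  incident-joins : ∀ {e x y w} → Joins e x y → Incident e w → w ≡ x ⊎ w ≡ y
  incident-joins (inj₁ eq) (inj₁ p) = inj₁ (trans (sym p) (cong proj₁ eq))
  incident-joins (inj₁ eq) (inj₂ p) = inj₂ (trans (sym p) (cong proj₂ eq))
  incident-joins (inj₂ eq) (inj₁ p) = inj₂ (trans (sym p) (cong proj₁ eq))
  incident-joins (inj₂ eq) (inj₂ p) = inj₁ (trans (sym p) (cong proj₂ eq))

  otherEnd-unique : ∀ {e w x} → Joins e w x → otherEnd e w ≡ x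
  otherEnd-unique {e} {w} j with proj₁ (ends e) ≟ⱽ w | j
  ... | yes _ | inj₁ eq = cong proj₂ eq
  ... | yes p | inj₂ eq = contradiction
                            (trans (cong proj₂ eq) (sym p)) (loopless e ∘ sym)
  ... | no ¬p | inj₁ eq = contradiction (cong proj₁ eq) ¬p
  ... | no ¬p | inj₂ eq = cong proj₁ eq

  otherEnd-joins : ∀ {e w} → Incident e w → Joins e w (otherEnd e w)
  otherEnd-joins {e} {w} i with proj₁ (ends e) ≟ⱽ w | i
  ... | yes refl | _     = inj₁ refl
  ... | no ¬p | inj₁ p   = contradiction p ¬p
  ... | no ¬p | inj₂ refl = inj₂ refl

  ∖-split : ∀ M H e → e ∈ H → e ∈ M ⊎ e ∈ H ∖ M
  ∖-split M H e e∈H with M e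
  ... | true  = inj₁ tt
  ... | false = inj₂ (Equivalence.from T-∧ (e∈H , tt))

  degree-∖ : ∀ {M H} → M ⊆ H → ∀ w →
             degreeIn H w ≡ degreeIn M w + degreeIn (H ∖ M) w
  degree-∖ {M} {H} M⊆H w = size-refinement-⊎ finite-E
    (at? H w) (at? M w) (at? (H ∖ M) w) split
    (λ { {e} (e∈M , i) → M⊆H e e∈M , i })
    (λ { {e} (e∈N , i) → proj₁ (Equivalence.to T-∧ e∈N) , i })
    (λ { {e} (e∈M , _) (e∈N , _) →
         T-not {M e} e∈M (proj₂ (Equivalence.to (T-∧ {H e}) e∈N)) })
    where
    split : ∀ {e} → At H w e → At M w e ⊎ At (H ∖ M) w e
    split {e} (e∈H , i) = Sum.map (_, i) (_, i) (∖-split M H e e∈H)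

  -- Degrees subtract, `2 = 1 + 1`. A Hamiltonian cycle through `M` thus splits into two perfect
  -- matchings, each with its own mate involution.
  hamiltonian-∖ : ∀ {M H} → PerfectMatching M → HamiltonianCycle H → M ⊆ H →
                  PerfectMatching (H ∖ M)
  hamiltonian-∖ {M} {H} pm (H-regular , _) M⊆H w = ℕ.+-cancelˡ-≡ 1 _ _ (begin
    1 + degreeIn (H ∖ M) w             ≡⟨ cong (_+ degreeIn (H ∖ M) w) (pm w) ⟨
    degreeIn M w + degreeIn (H ∖ M) w  ≡⟨ degree-∖ M⊆H w ⟨
    degreeIn H w                       ≡⟨ H-regular w ⟩
    2                                  ∎)
    where open ≡-Reasoning

  -- Send each vertex satisfying `P` to its edge of `M`, tagged by which of the two ends it is: a
  -- bijection onto two copies of `M`. Looplessness makes the tag unambiguous.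
  size-matched : {P : Pred V 0ℓ} (P? : Decidable P) (M : EdgeSet) →
    (∀ {w} → P w → ∃ (OnlyEdge M w)) →
    (∀ {e w} → At M w e → P w) →
    ∃ λ m → size (finite-refinement finite-V P?) ≡ 2 * m
  size-matched {P} P? M matched endsP = size fM , (begin
      size fP                        ≡⟨ size-cong fP (finite-⊎ fM fM) P↔M⊎M ⟩
      size fM + size fM              ≡⟨ cong (size fM +_) (ℕ.+-identityʳ _) ⟨
      2 * size fM                    ∎)
    where
    open ≡-Reasoning
    fM = finite-refinement finite-E (λ e → T? (M e))
    fP = finite-refinement finite-V P?
    edge : ∀ w → .(P w) → ∃ (OnlyEdge M w)
    edge w p = matched (recompute (P? w) p)
    tag : ∀ {e w} → e ∈ M → Incident e w → [ e ∈ E ∣ e ∈ M ] ⊎ [ e ∈ E ∣ e ∈ M ]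
    tag {e} m (inj₁ _) = inj₁ (e , [ m ])
    tag {e} m (inj₂ _) = inj₂ (e , [ m ])
    to : [ w ∈ V ∣ P w ] → [ e ∈ E ∣ e ∈ M ] ⊎ [ e ∈ E ∣ e ∈ M ]
    to (w , [ p ]) = let e , (m , i) , _ = edge w p in tag m i
    from : [ e ∈ E ∣ e ∈ M ] ⊎ [ e ∈ E ∣ e ∈ M ] → [ w ∈ V ∣ P w ]
    from (inj₁ (e , [ m ])) = proj₁ (ends e) , [ endsP (m , inj₁ refl) ]
    from (inj₂ (e , [ m ])) = proj₂ (ends e) , [ endsP (m , inj₂ refl) ]
    from-tag : ∀ {e w} .(p : P w) (m : e ∈ M) (i : Incident e w) →
               from (tag m i) ≡ (w , [ p ])
    from-tag p m (inj₁ eq) = value-injective eq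
    from-tag p m (inj₂ eq) = value-injective eq
    tag₁ : ∀ {e e′} .(m : e ∈ M) (m′ : e′ ∈ M) (i : Incident e′ (proj₁ (ends e))) →
           e ≡ e′ → tag m′ i ≡ inj₁ (e , [ m ])
    tag₁ m m′ (inj₁ _)      refl = refl
    tag₁ {e} m m′ (inj₂ eq) refl = contradiction (sym eq) (loopless e)
    tag₂ : ∀ {e e′} .(m : e ∈ M) (m′ : e′ ∈ M) (i : Incident e′ (proj₂ (ends e))) →
           e ≡ e′ → tag m′ i ≡ inj₂ (e , [ m ])
    tag₂ {e} m m′ (inj₁ eq) refl = contradiction eq (loopless e)
    tag₂ m m′ (inj₂ _)      refl = refl
    to∘from : ∀ s → to (from s) ≡ s
    to∘from (inj₁ (e , [ m ])) =
      let e′ , (m′ , i) , unique = edge (proj₁ (ends e)) (endsP (m , inj₁ refl))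
      in tag₁ m m′ i (unique (recompute (T? (M e)) m , inj₁ refl))
    to∘from (inj₂ (e , [ m ])) =
      let e′ , (m′ , i) , unique = edge (proj₂ (ends e)) (endsP (m , inj₂ refl))
      in tag₂ m m′ i (unique (recompute (T? (M e)) m , inj₂ refl))
    from∘to : ∀ x → from (to x) ≡ x
    from∘to (w , [ p ]) = let e , (m , i) , _ = edge w p in from-tag p m i
    P↔M⊎M : [ w ∈ V ∣ P w ] ↔ ([ e ∈ E ∣ e ∈ M ] ⊎ [ e ∈ E ∣ e ∈ M ])
    P↔M⊎M = mk↔ₛ′ to from to∘from from∘to

  covered? : ∀ F w → Dec (Covered F w)
  covered? F w with size (finite-refinement finite-E (at? F w)) in eq
  ... | ℕ.zero = no λ { (e , p) → Fin.¬Fin0 (subst Fin eq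
                   (Inverse.to (enumeration (finite-refinement finite-E (at? F w)))
                     (e , [ p ]))) }
  ... | suc _  with e , [ p ] ← Inverse.from
                      (enumeration (finite-refinement finite-E (at? F w)))
                      (subst Fin (sym eq) zero)
               = yes (e , recompute (at? F w e) p)

  -- Otherwise both V and V minus z would be perfectly matched,
  -- so both would have even size.
  parity : HasPerfectMatching → ∀ z F → (∀ {w} → w ≢ z → degreeIn F w ≡ 1) →
           Covered F z
  parity (N , N-perfect) z F F-matched = decidable-stable (covered? F z) λ uncovered →
    let m , V≡2m  = size-matched (λ _ → yes tt) N (λ {w} _ → onlyEdge N (N-perfect w)) (λ _ → tt)
        k , V′≡2k = size-matched (λ w → ¬? (w ≟ⱽ z)) F (λ w≢z → onlyEdge F (F-matched w≢z))
                      (λ { {e} p refl → uncovered (e , p) })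
    in ℕ.even≢odd m k (begin
      2 * m      ≡⟨ V≡2m ⟨
      size (finite-refinement finite-V (λ _ → yes tt))
                 ≡⟨ size-refinement-⊎ finite-V (λ _ → yes tt) (_≟ⱽ z) (λ w → ¬? (w ≟ⱽ z))
                      (λ {w} _ → split w) (λ _ → tt) (λ _ → tt) (λ p ¬p → ¬p p) ⟩
      size (finite-refinement finite-V (_≟ⱽ z)) +
      size (finite-refinement finite-V (λ w → ¬? (w ≟ⱽ z)))
                 ≡⟨ cong₂ _+_ (contractible⇒size≡1 (finite-refinement finite-V (_≟ⱽ z))
                      ((z , [ refl ]) , λ { (w , [ p ]) →
                         value-injective (recompute (w ≟ⱽ z) p) })) V′≡2k ⟩
      suc (2 * k) ∎)
    where
    open ≡-Reasoning
    split : ∀ w → w ≡ z ⊎ w ≢ z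
    split w with w ≟ⱽ z
    ... | yes p = inj₁ p
    ... | no ¬p = inj₂ ¬p

  -- The mate involution, and deleting a vertex from a Hamiltonian cycle

  module Mate (M : EdgeSet) (pm : PerfectMatching M) where

    edgeAt : V → E
    edgeAt w = proj₁ (onlyEdge M (pm w))

    mate : V → V
    mate w = otherEnd (edgeAt w) w

    edgeAt-only : ∀ w → OnlyEdge M w (edgeAt w)
    edgeAt-only w = proj₂ (onlyEdge M (pm w))

    mate-joins : ∀ w → Joins (edgeAt w) w (mate w)
    mate-joins w = otherEnd-joins (proj₂ (proj₁ (edgeAt-only w)))

    joins⇒mate : ∀ {e x y} → e ∈ M → Joins e x y → y ≡ mate x
    joins⇒mate {x = x} m j with refl ← proj₂ (edgeAt-only x) (m , joins⇒incident j) =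
      sym (otherEnd-unique j)

    mate-involutive : ∀ w → mate (mate w) ≡ w
    mate-involutive w = sym (joins⇒mate (proj₁ (proj₁ (edgeAt-only w)))
                               (joins-sym (mate-joins w)))

    mate-free : ∀ w → mate w ≢ w
    mate-free w = joins⇒≢ (mate-joins w) ∘ sym

  open Mate public using (mate; mate-joins)

  AdjacentOff : V → EdgeSet → V → V → Set
  AdjacentOff v H x y = x ≢ v × y ≢ v × Adjacent H x y

  -- Every edge of `H` is a step of one of two mate involutions, so `connected-off` applies. The
  -- walk is made to end at the `M`-mate of `v` because the halves will be linked through the cut
  -- edge lying in the matching.
  hamiltonian-off : ∀ {M H} (pm : PerfectMatching M) → HamiltonianCycle H → M ⊆ H →
                    ∀ {v w} → w ≢ v → Star (AdjacentOff v H) w (mate M pm v)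
  hamiltonian-off {M} {H} pm ham M⊆H {v} {w} w≢v =
    Star.map off⇒adjacent
      (connected-off (Star.map adjacent⇒step (proj₂ ham w v)) w≢v)
    where
    pm′ = hamiltonian-∖ {M} {H} pm ham M⊆H
    module M = Mate M pm
    module N = Mate (H ∖ M) pm′
    open Involutions finite-V M.mate N.mate M.mate-involutive N.mate-involutive
                     M.mate-free N.mate-free
    adjacent⇒step : ∀ {x y} → Adjacent H x y → Step x y
    adjacent⇒step (e , e∈H , j) =
      Sum.map (λ m → M.joins⇒mate m j) (λ n → N.joins⇒mate n j) (∖-split M H e e∈H)
    off⇒adjacent : ∀ {x y} → StepOff v x y → AdjacentOff v H x y
    off⇒adjacent {x} (x≢v , y≢v , inj₁ refl) = x≢v , y≢v ,
      M.edgeAt x , M⊆H _ (proj₁ (proj₁ (M.edgeAt-only x))) , M.mate-joins x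
    off⇒adjacent {x} (x≢v , y≢v , inj₂ refl) = x≢v , y≢v ,
      N.edgeAt x , proj₁ (Equivalence.to T-∧ (proj₁ (proj₁ (N.edgeAt-only x)))) ,
      N.mate-joins x

-- Star products

module OrderingProperties {S : Multigraph} {s : Multigraph.V S} (γ : Ordering S s) where

  open Multigraph S
  open Edges S

  edge : Fin 3 → E
  edge i = value (Inverse.to γ i)

  incident-edge : ∀ i → Incident (edge i) s
  incident-edge i with e , [ p ] ← Inverse.to γ i = recompute (incident? e s) p

  edge-index : ∀ {e} → Incident e s → ∃ λ i → e ≡ edge i
  edge-index p = Inverse.from γ (_ , [ p ]) ,
                 cong value (sym (Inverse.strictlyInverseˡ γ (_ , [ p ])))

  edge-injective : Injective _≡_ _≡_ edge
  edge-injective = Injection.injective (↔⇒↣ γ) ∘ value-injective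

  end : Fin 3 → [ w ∈ V ∣ w ≢ s ]
  end i = otherEnd (edge i) s , [ otherEnd-≢ (edge i) s ]

  joins-edge : ∀ i → Joins (edge i) s (value (end i))
  joins-edge i = otherEnd-joins (incident-edge i)

-- How S − s sits in a star product U on s: the edges at s become the cut.
record Half (S : Multigraph) {s : Multigraph.V S} (γ : Ordering S s)
            (U : Multigraph) : Set where
  private
    module S = Multigraph S
    module U = Multigraph U
  open OrderingProperties {S} γ using (end)
  field
    ι             : [ w ∈ S.V ∣ w ≢ s ] → U.V
    off           : [ e ∈ S.E ∣ ¬ S.Incident e s ] → U.E
    cut           : Fin 3 → U.E
    off-injective : Injective _≡_ _≡_ off
    cut-injective : Injective _≡_ _≡_ cut
    off≢cut       : ∀ {e i} → off e ≢ cut i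
    joins-off     : ∀ e x y → S.Joins (value e) (value x) (value y) →
                    U.Joins (off e) (ι x) (ι y)
    incident-off  : ∀ e w → S.Incident (value e) (value w) → U.Incident (off e) (ι w)
    incident-cut  : ∀ i → U.Incident (cut i) (ι (end i))
    incident-ι    : ∀ {f w} → U.Incident f (ι w) →
                    (∃ λ e → f ≡ off e × S.Incident (value e) (value w)) ⊎
                    (∃ λ i → f ≡ cut i × w ≡ end i)

module HalfProperties {S : Multigraph} {s : Multigraph.V S} (γ : Ordering S s)
                      {U : Multigraph} (half : Half S γ U) where

  private
    module S where
      open Multigraph S public
      open Edges S public
    module U where
      open Multigraph U public
      open Edges U public
  open Half half

  open OrderingProperties {S} γ

  -- A view whose indices have the shapes on which `κ-off` and `κ-edge` evaluate `κ`.
  data Kind : S.E → Set where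
    isOff : (e : [ e ∈ S.E ∣ ¬ S.Incident e s ]) → Kind (value e)
    isCut : ∀ i → Kind (edge i)

  kind : ∀ e → Kind e
  kind e with S.incident? e s
  ... | no ¬p = isOff (e , [ ¬p ])
  ... | yes p with i , refl ← edge-index p = isCut i

  -- Pulling an edge set of `U` back along `κ` amounts to contracting the other half of `U` to the
  -- single vertex `s`.
  κ : S.E → U.E
  κ e with S.incident? e s
  ... | no ¬p = off (e , [ ¬p ])
  ... | yes p = cut (Inverse.from γ (e , [ p ]))

  κ-off : ∀ e → κ (value e) ≡ off e
  κ-off (e , [ ¬p ]) with S.incident? e s
  ... | no _  = refl
  -- The refinement holds `¬p` irrelevantly, so the contradiction is irrelevant too; `⊥` being
  -- decidable, `recompute` makes it usable.
  ... | yes p = ⊥-elim (recompute (no λ ()) (¬p p))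

  κ-edge : ∀ i → κ (edge i) ≡ cut i
  κ-edge i with S.incident? (edge i) s
  ... | no ¬p = contradiction (incident-edge i) ¬p
  ... | yes p = cong cut (Inverse.strictlyInverseʳ γ i)

  κ-injective : Injective _≡_ _≡_ κ
  κ-injective {e} {e′} eq with kind e | kind e′
  ... | isOff a | isOff b = cong value
          (off-injective (trans (sym (κ-off a)) (trans eq (κ-off b))))
  ... | isOff a | isCut j = contradiction
          (trans (sym (κ-off a)) (trans eq (κ-edge j))) off≢cut
  ... | isCut i | isOff b = contradiction
          (trans (sym (κ-off b)) (trans (sym eq) (κ-edge i))) off≢cut
  ... | isCut i | isCut j = cong edge
          (cut-injective (trans (sym (κ-edge i)) (trans eq (κ-edge j))))

  κ-incident : ∀ {e} w → S.Incident e (value w) → U.Incident (κ e) (ι w)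
  κ-incident {e} w p with kind e
  ... | isOff a = subst (λ f → U.Incident f (ι w)) (sym (κ-off a)) (incident-off a w p)
  ... | isCut i with S.incident-joins (joins-edge i) p
  ...   | inj₁ w≡s = ⊥-elim (w≢s w w≡s)
    where
    w≢s : ∀ (x : [ w ∈ S.V ∣ w ≢ s ]) → value x ≢ s
    w≢s (x , [ q ]) = recompute (¬? (x S.≟ⱽ s)) q
  ...   | inj₂ w≡end = subst (λ f → U.Incident f (ι w)) (sym (κ-edge i))
            (subst (λ x → U.Incident (cut i) (ι x)) (sym (value-injective w≡end))
              (incident-cut i))

  incident-κ : ∀ {f} w → U.Incident f (ι w) →
               ∃ λ e → κ e ≡ f × S.Incident e (value w)
  incident-κ w p with incident-ι p
  ... | inj₁ (e , refl , q)    = value e , κ-off e , q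
  ... | inj₂ (i , refl , refl) = edge i , κ-edge i ,
          S.joins⇒incident (S.joins-sym (joins-edge i))

  -- A pointwise equation, rather than `F′` defined as the pullback, serves both restrictions, where
  -- it is `refl`, and glued sets, where it is `glue-L` or `glue-R`.
  module _ {F : U.EdgeSet} {F′ : S.EdgeSet} (F∘κ≗F′ : F ∘ κ ≗ F′) where

    degree-ι : ∀ w → U.degreeIn F (ι w) ≡ S.degreeIn F′ (value w)
    degree-ι w = sym (size-refinement-↔ S.finite-E U.finite-E
      (S.at? F′ (value w)) (U.at? F (ι w)) κ κ-injective
      (λ { {e} (m , p) → subst T (sym (F∘κ≗F′ e)) m , κ-incident w p })
      (λ { {f} (m , p) → let e , eq , q = incident-κ w p in
             e , eq , subst T (trans (cong F (sym eq)) (F∘κ≗F′ e)) m , q }))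

    covered-ι : ∀ w → U.Covered F (ι w) → S.Covered F′ (value w)
    covered-ι w (f , m , p) = let e , eq , q = incident-κ w p in
      e , subst T (trans (cong F (sym eq)) (F∘κ≗F′ e)) m , q

    -- A walk avoiding `s` uses no edge at `s`, so each of its edges survives in `U` as an `off`
    -- edge.
    lift-off : ∀ {x y} (p : x ≢ s) (q : y ≢ s) → Star (S.AdjacentOff s F′) x y →
               Star (U.Adjacent F) (ι (x , [ p ])) (ι (y , [ q ]))
    lift-off p q ε = ε
    lift-off {x} p q (_◅_ {j = y} (x≢s , y≢s , e , m , j) rest) =
      (off e° , subst T (trans (sym (F∘κ≗F′ e)) (cong F (κ-off e°))) m ,
       joins-off e° (x , [ p ]) (y , [ y≢s ]) j) ◅ lift-off y≢s q rest
      where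
      e≁s : ¬ S.Incident e s
      e≁s i with S.incident-joins j i
      ... | inj₁ s≡x = x≢s (sym s≡x)
      ... | inj₂ s≡y = y≢s (sym s≡y)
      e° : [ e ∈ S.E ∣ ¬ S.Incident e s ]
      e° = e , [ e≁s ]

-- Among the three labels, both sets contain `i` and no other.
onlyEdges-agree :
  {G : Multigraph} {v : Multigraph.V G} (α : Ordering G v)
  {G′ : Multigraph} {z : Multigraph.V G′} (β : Ordering G′ z)
  (F : Multigraph.EdgeSet G) (F′ : Multigraph.EdgeSet G′) → ∀ i →
  Edges.OnlyEdge G F v (OrderingProperties.edge {G} α i) →
  Edges.OnlyEdge G′ F′ z (OrderingProperties.edge {G′} β i) →
  ∀ j → F (OrderingProperties.edge {G} α j) ≡ F′ (OrderingProperties.edge {G′} β j)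
onlyEdges-agree {G} α {G′} β F F′ i ((m , _) , only) ((m′ , _) , only′) j =
  T-injective
    (λ n → subst (T ∘ F′ ∘ β.edge) (sym (α.edge-injective (only (n , α.incident-edge j)))) m′)
    (λ n → subst (T ∘ F ∘ α.edge) (sym (β.edge-injective (only′ (n , β.incident-edge j)))) m)
  where
  module α = OrderingProperties {G} α
  module β = OrderingProperties {G′} β

-- Gluing edge sets across the cut of a star product

module StarProduct (G : Multigraph) {v : Multigraph.V G} (α : Ordering G v)
                   (G′ : Multigraph) {z : Multigraph.V G′} (β : Ordering G′ z) where

  G⋆ : Multigraph
  G⋆ = starProduct G α G′ β

  private
    module G where
      open Multigraph G public
      open Edges G public
    module G′ where
      open Multigraph G′ public
      open Edges G′ public
    module ⋆ where
      open Multigraph G⋆ public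
      open Edges G⋆ public

  leftHalf : Half G α G⋆
  leftHalf = record
    { ι             = inj₁
    ; off           = inj₁
    ; cut           = λ i → inj₂ (inj₂ i)
    ; off-injective = inj₁-injective
    ; cut-injective = inj₂-injective ∘ inj₂-injective
    ; off≢cut       = λ ()
    ; joins-off     = λ _ _ _ → Sum.map
        (λ eq → cong₂ _,_ (cong inj₁ (value-injective (cong proj₁ eq)))
                          (cong inj₁ (value-injective (cong proj₂ eq))))
        (λ eq → cong₂ _,_ (cong inj₁ (value-injective (cong proj₁ eq)))
                          (cong inj₁ (value-injective (cong proj₂ eq))))
    ; incident-off  = λ _ _ → Sum.map (λ p → cong inj₁ (value-injective p))
                                      (λ p → cong inj₁ (value-injective p))
    ; incident-cut  = λ _ → inj₁ refl
    ; incident-ι    = λ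
      { {inj₁ e} p → inj₁ (e , refl , Sum.map (cong value ∘ inj₁-injective)
                                              (cong value ∘ inj₁-injective) p)
      ; {inj₂ (inj₁ _)} (inj₁ ())
      ; {inj₂ (inj₁ _)} (inj₂ ())
      ; {inj₂ (inj₂ i)} (inj₁ p) → inj₂ (i , refl , sym (inj₁-injective p)) }
    }

  rightHalf : Half G′ β G⋆
  rightHalf = record
    { ι             = inj₂
    ; off           = λ e → inj₂ (inj₁ e)
    ; cut           = λ i → inj₂ (inj₂ i)
    ; off-injective = inj₁-injective ∘ inj₂-injective
    ; cut-injective = inj₂-injective ∘ inj₂-injective
    ; off≢cut       = λ ()
    ; joins-off     = λ _ _ _ → Sum.map
        (λ eq → cong₂ _,_ (cong inj₂ (value-injective (cong proj₁ eq)))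
                          (cong inj₂ (value-injective (cong proj₂ eq))))
        (λ eq → cong₂ _,_ (cong inj₂ (value-injective (cong proj₁ eq)))
                          (cong inj₂ (value-injective (cong proj₂ eq))))
    ; incident-off  = λ _ _ → Sum.map (λ p → cong inj₂ (value-injective p))
                                      (λ p → cong inj₂ (value-injective p))
    ; incident-cut  = λ _ → inj₂ refl
    ; incident-ι    = λ
      { {inj₁ _} (inj₁ ())
      ; {inj₁ _} (inj₂ ())
      ; {inj₂ (inj₁ e)} p → inj₁ (e , refl , Sum.map (cong value ∘ inj₂-injective)
                                                     (cong value ∘ inj₂-injective) p)
      ; {inj₂ (inj₂ i)} (inj₂ p) → inj₂ (i , refl , sym (inj₂-injective p)) }
    }

  open OrderingProperties {G} α public using ()
    renaming (edge to a-edge; edge-index to a-index; incident-edge to a-incident;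
              edge-injective to a-injective; end to a; joins-edge to a-joins)
  open OrderingProperties {G′} β public using ()
    renaming (edge to b-edge; edge-index to b-index; incident-edge to b-incident;
              end to b; joins-edge to b-joins)

  module L = HalfProperties {G} α leftHalf
  module R = HalfProperties {G′} β rightHalf

  -- The cut edges are read from `F`; reading them from `F′` gives the same set as soon as the two
  -- agree on the labels.
  glue : G.EdgeSet → G′.EdgeSet → ⋆.EdgeSet
  glue F F′ (inj₁ e)        = F (value e)
  glue F F′ (inj₂ (inj₁ e)) = F′ (value e)
  glue F F′ (inj₂ (inj₂ i)) = F (a-edge i)

  module _ (F : G.EdgeSet) (F′ : G′.EdgeSet)
           (agree : ∀ i → F (a-edge i) ≡ F′ (b-edge i)) where

    glue-L : glue F F′ ∘ L.κ ≗ F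
    glue-L e with L.kind e
    ... | L.isOff e° = cong (glue F F′) (L.κ-off e°)
    ... | L.isCut i  = cong (glue F F′) (L.κ-edge i)

    glue-R : glue F F′ ∘ R.κ ≗ F′
    glue-R e with R.kind e
    ... | R.isOff e° = cong (glue F F′) (R.κ-off e°)
    ... | R.isCut i  = trans (cong (glue F F′) (R.κ-edge i)) (agree i)

    glue-regular : ∀ {d} → G.Regular d F → G′.Regular d F′ → ⋆.Regular d (glue F F′)
    glue-regular F-regular F′-regular (inj₁ w) =
      trans (L.degree-ι {glue F F′} {F} glue-L w) (F-regular (value w))
    glue-regular F-regular F′-regular (inj₂ w) =
      trans (R.degree-ι {glue F F′} {F′} glue-R w) (F′-regular (value w))

  adjacent-sym : ∀ {F x y} → ⋆.Adjacent F x y → ⋆.Adjacent F y x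
  adjacent-sym (e , m , j) = e , m , ⋆.joins-sym j

  -- Both halves are traversed by paths of the two cycles, which are linked
  -- through the cut edge coming from the two matchings.
  glue-hamiltonian :
    ∀ {M H M′ H′} (pm : G.PerfectMatching M) (pm′ : G′.PerfectMatching M′) →
    G.HamiltonianCycle H → G′.HamiltonianCycle H′ → M G.⊆ H → M′ G′.⊆ H′ →
    (∀ i → H (a-edge i) ≡ H′ (b-edge i)) →
    ∀ i → a-edge i G.∈ M → b-edge i G′.∈ M′ →
    ⋆.HamiltonianCycle (glue H H′)
  glue-hamiltonian {M} {H} {M′} {H′} pm pm′ ham ham′ M⊆H M′⊆H′ agree i m m′ =
    glue-regular H H′ agree (proj₁ ham) (proj₁ ham′) , connected
    where
    a≡mate : value (a i) ≡ G.mate M pm v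
    a≡mate = G.Mate.joins⇒mate M pm m (a-joins i)
    b≡mate : value (b i) ≡ G′.mate M′ pm′ z
    b≡mate = G′.Mate.joins⇒mate M′ pm′ m′ (b-joins i)
    _⇝_ : ⋆.V → ⋆.V → Set
    _⇝_ = Star (⋆.Adjacent (glue H H′))
    L⇝ : ∀ w → inj₁ w ⇝ inj₁ (a i)
    L⇝ (w , [ p ]) = L.lift-off {glue H H′} {H} (glue-L H H′ agree) w≢v a≢v
      (subst (Star (G.AdjacentOff v H) w) (sym a≡mate)
        (G.hamiltonian-off {M} {H} pm ham M⊆H w≢v))
      where
      w≢v = recompute (¬? (w G.≟ⱽ v)) p
      a≢v = G.otherEnd-≢ (a-edge i) v
    R⇝ : ∀ w → inj₂ w ⇝ inj₂ (b i)
    R⇝ (w , [ p ]) = R.lift-off {glue H H′} {H′} (glue-R H H′ agree) w≢z b≢z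
      (subst (Star (G′.AdjacentOff z H′) w) (sym b≡mate)
        (G′.hamiltonian-off {M′} {H′} pm′ ham′ M′⊆H′ w≢z))
      where
      w≢z = recompute (¬? (w G′.≟ⱽ z)) p
      b≢z = G′.otherEnd-≢ (b-edge i) z
    ⇝a : ∀ x → x ⇝ inj₁ (a i)
    ⇝a (inj₁ w) = L⇝ w
    ⇝a (inj₂ w) = R⇝ w ◅◅ return (inj₂ (inj₂ i) , M⊆H (a-edge i) m , inj₂ refl)
    connected : ⋆.ConnectedSpanning (glue H H′)
    connected x y = ⇝a x ◅◅ reverse (adjacent-sym {glue H H′}) (⇝a y)

-- Perfect matchings through successive star products

-- At the listed vertices, still to be replaced, parity gives only "at least one edge"; this
-- property upgrades it to "exactly one". It passes to star products by `tight⋆`.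
Tight : ∀ {k} (G : Multigraph) → Fin k ↣ Multigraph.V G → Set
Tight G w =
  ∀ M → (∀ x → Covered M x) →
  (∀ x → (∀ j → Injection.to w j ≢ x) → degreeIn M x ≡ 1) → PerfectMatching M
  where
  open Multigraph G
  open Edges G

-- The classes have equal size, so choosing an edge of M at each v i and
-- passing to its other end is an injection v → u, hence onto.
bipartite-tight : ∀ {G n k} (B : Bipartition G n) (w : Fin k ↣ Multigraph.V G) →
                  (∀ j i → Injection.to w j ≢ Bipartition.u B i) → Tight G w
bipartite-tight {G} {n} B w w≢u M covered matched = perfect
  where
  open Multigraph G
  open Edges G
  open Bipartition B
  u≢v : ∀ {i j} → u i ≢ v j
  u≢v eq with () ← Injection.injective (↔⇒↣ classes) eq
  v-injective : ∀ {i j} → v i ≡ v j → i ≡ j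
  v-injective = Injection.injective v↣
  chosen : Fin n → E
  chosen i = proj₁ (covered (v i))
  chosen-at : ∀ i → At M (v i) (chosen i)
  chosen-at i = proj₂ (covered (v i))
  v-end : ∀ {e i j l} → Joins e (u i) (v j) → Incident e (v l) → l ≡ j
  v-end j p with incident-joins j p
  ... | inj₁ eq = contradiction (sym eq) u≢v
  ... | inj₂ eq = v-injective eq
  φ : Fin n → Fin n
  φ i = proj₁ (bipartite (chosen i))
  chosen-at-φ : ∀ i → At M (u (φ i)) (chosen i)
  chosen-at-φ i = proj₁ (chosen-at i) ,
    joins⇒incident (proj₂ (proj₂ (bipartite (chosen i))))
  only-u : ∀ i {e e′} → At M (u i) e → At M (u i) e′ → e ≡ e′
  only-u i p p′ with _ , _ , only ← onlyEdge M (matched (u i) (λ j → w≢u j i)) =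
    trans (only p) (sym (only p′))
  chosen-injective : ∀ {i j} → chosen i ≡ chosen j → i ≡ j
  chosen-injective {i} {j} eq with a , b , ab ← bipartite (chosen i) = trans
    (v-end ab (proj₂ (chosen-at i)))
    (sym (v-end ab (subst (λ e → Incident e (v j)) (sym eq) (proj₂ (chosen-at j)))))
  φ-injective : Injective _≡_ _≡_ φ
  φ-injective {i} {j} eq = chosen-injective (only-u (φ i) (chosen-at-φ i)
    (subst (λ l → At M (u l) (chosen j)) (sym eq) (chosen-at-φ j)))
  only-v : ∀ i {e} → At M (v i) e → e ≡ chosen i
  only-v i {e} (m , p)
    -- As `φ` is onto, the `u`-end of `e` is `u (φ i′)`, whose only edge in `M` is `chosen i′`.
    -- Hence `e` is `chosen i′`, and comparing `v`-ends gives `i′ ≡ i`.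
    with a , b , ab ← bipartite e
    with i′ , refl ← fin-injective⇒surjective φ-injective a
    with refl ← only-u (φ i′) (m , joins⇒incident ab) (chosen-at-φ i′)
    = cong chosen (trans (v-end ab (proj₂ (chosen-at i′))) (sym (v-end ab p)))
  perfect : PerfectMatching M
  perfect x with Inverse.from classes x | Inverse.strictlyInverseˡ classes x
  ... | inj₁ i | refl = matched (u i) (λ j → w≢u j i)
  ... | inj₂ i | refl = onlyEdge⇒degree≡1 M (chosen i , chosen-at i , only-v i)

-- A single star product: tightness and PMH are preserved

module StarStep {k} (G : Multigraph) (w : Fin (suc k) ↣ Multigraph.V G)
                (α : Ordering G (Injection.to w zero))
                (G′ : Multigraph) {z : Multigraph.V G′} (β : Ordering G′ z)
                (tight : Tight G w) (malleable : Malleable G′ z 3) where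

  open StarProduct G α G′ β

  private
    v : Multigraph.V G
    v = Injection.to w zero
    module G where
      open Multigraph G public
      open Edges G public
    module G′ where
      open Multigraph G′ public
      open Edges G′ public
    module ⋆ where
      open Multigraph G⋆ public
      open Edges G⋆ public

  -- The restrictions M₁ and M₂ are kept opaque: unfolding κ is expensive.
  module Restriction (M : ⋆.EdgeSet) (M₁ : G.EdgeSet) (M₂ : G′.EdgeSet)
                     (M∘κ≗M₁ : M ∘ L.κ ≗ M₁) (M∘κ≗M₂ : M ∘ R.κ ≗ M₂) where

    restrict-agree : ∀ i → M₁ (a-edge i) ≡ M₂ (b-edge i)
    restrict-agree i = begin
      M₁ (a-edge i)       ≡⟨ M∘κ≗M₁ (a-edge i) ⟨
      M (L.κ (a-edge i))  ≡⟨ cong M (L.κ-edge i) ⟩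
      M (inj₂ (inj₂ i))   ≡⟨ cong M (R.κ-edge i) ⟨
      M (R.κ (b-edge i))  ≡⟨ M∘κ≗M₂ (b-edge i) ⟩
      M₂ (b-edge i)       ∎
      where open ≡-Reasoning

    module _
      (covered : ∀ x → ⋆.Covered M x)
      (matched : ∀ x → (∀ j → Injection.to (remaining G α G′ β w refl) j ≢ x) →
                 ⋆.degreeIn M x ≡ 1) where

      matched₂ : ∀ {x} → x ≢ z → G′.degreeIn M₂ x ≡ 1
      matched₂ {x} x≢z = trans
        (sym (R.degree-ι {M} {M₂} M∘κ≗M₂ (x , [ x≢z ])))
        -- The vertices still to be treated all lie in the left half, so none of them is an `inj₂`.
        (matched (inj₂ (x , [ x≢z ])) (λ _ ()))

      -- `M₂` has degree 1 at every vertex of `G′` except possibly `z`, so parity yields an edge of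
      -- `M₂` at `z`; the edge at `v` with the same label lies in `M₁`.
      covered-v : G.Covered M₁ v
      covered-v =
        let e , m , p = G′.parity (proj₁ (proj₂ (proj₂ malleable))) z M₂ matched₂
            j , e≡b   = b-index p
        in a-edge j , subst T (sym (restrict-agree j)) (subst (T ∘ M₂) e≡b m) ,
           a-incident j

      covered₁ : ∀ x → G.Covered M₁ x
      covered₁ x = cases (x G.≟ⱽ v)
        where
        cases : Dec (x ≡ v) → G.Covered M₁ x
        cases (yes x≡v) = subst (G.Covered M₁) (sym x≡v) covered-v
        cases (no x≢v)  = L.covered-ι {M} {M₁} M∘κ≗M₁ (x , [ x≢v ]) (covered _)

      matched₁ : ∀ x → (∀ j → Injection.to w j ≢ x) → G.degreeIn M₁ x ≡ 1
      matched₁ x w≢x = trans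
        (sym (L.degree-ι {M} {M₁} M∘κ≗M₁ (x , [ w≢x zero ∘ sym ])))
        (matched (inj₁ (x , [ w≢x zero ∘ sym ]))
          (λ j eq → w≢x (suc j) (cong value (inj₁-injective eq))))

      perfect₁ : G.PerfectMatching M₁
      perfect₁ = tight M₁ covered₁ matched₁

      -- The converse transfer: tightness has made the edge of `M₁` at `v` unique, and equal labels
      -- carry this uniqueness over to `z`.
      onlyEdge-z : ∃ (G′.OnlyEdge M₂ z)
      onlyEdge-z =
        let e , (m , p) , only = G.onlyEdge M₁ (perfect₁ v)
            i , e≡a = a-index p
        in b-edge i ,
           (subst T (restrict-agree i) (subst (T ∘ M₁) e≡a m) , b-incident i) ,
           λ { (m′ , p′) → let j , e′≡b = b-index p′ in
               trans e′≡b (cong b-edge (a-injective (trans (only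
                 (subst T (sym (restrict-agree j)) (subst (T ∘ M₂) e′≡b m′) ,
                  a-incident j)) e≡a))) }

      perfect₂ : G′.PerfectMatching M₂
      perfect₂ x = cases (x G′.≟ⱽ z)
        where
        cases : Dec (x ≡ z) → G′.degreeIn M₂ x ≡ 1
        cases (yes refl) = G′.onlyEdge⇒degree≡1 M₂ onlyEdge-z
        cases (no x≢z)   = matched₂ x≢z

  -- Contracting the right half reduces a left vertex to tightness of `G`; a right vertex is never
  -- listed, so its degree is given.
  tight⋆ : Tight G⋆ (remaining G α G′ β w refl)
  tight⋆ M covered matched (inj₁ x) = trans
    (L.degree-ι {M} {M ∘ L.κ} (λ _ → refl) x)
    (Restriction.perfect₁ M _ _ (λ _ → refl) (λ _ → refl) covered matched (value x))
  tight⋆ M covered matched (inj₂ x) = matched (inj₂ x) (λ _ ())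

  -- If the given perfect matching misses edge `i`, malleability extends it to a Hamiltonian cycle
  -- through that edge, and the complementary matching in this cycle contains it.
  matching-through : ∀ i → ∃ λ F → G′.PerfectMatching F × b-edge i G′.∈ F
  matching-through i = cases (T? (M (b-edge i)))
    where
    M = proj₁ (proj₁ (proj₂ (proj₂ malleable)))
    pm = proj₂ (proj₁ (proj₂ (proj₂ malleable)))
    cases : Dec (b-edge i G′.∈ M) → ∃ λ F → G′.PerfectMatching F × b-edge i G′.∈ F
    cases (yes m) = M , pm , m
    cases (no ¬m) =
      let H , hams , through = proj₂ (proj₂ (proj₂ malleable)) M pm
          j , h = through (b-edge i) (b-incident i) ¬m
      in H j G′.∖ M ,
         G′.hamiltonian-∖ {M} {H j} pm (proj₁ (hams j)) (proj₂ (hams j)) ,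
         ∖-intro h ¬m

  a-only : ∀ M → G.PerfectMatching M → ∃ λ i → G.OnlyEdge M v (a-edge i)
  a-only M pm =
    let e , only = G.onlyEdge M (pm v)
        i , e≡a  = a-index (proj₂ (proj₁ only))
    in i , subst (G.OnlyEdge M v) e≡a only

  matchings-agree :
    ∀ {M M′} → G.PerfectMatching M → G′.PerfectMatching M′ →
    ∀ i → a-edge i G.∈ M → b-edge i G′.∈ M′ → ∀ j → M (a-edge j) ≡ M′ (b-edge j)
  matchings-agree {M} {M′} pm pm′ i m m′ = onlyEdges-agree {G} α {G′} β M M′ i
    (G.onlyEdge-at M (pm v) (m , a-incident i))
    (G′.onlyEdge-at M′ (pm′ z) (m′ , b-incident i))

  module _ (pmh : PMH G) where

    perfect⋆ : ⋆.HasPerfectMatching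
    perfect⋆ =
      let M , pm            = proj₁ pmh
          i , ((m , _) , _) = a-only M pm
          M′ , pm′ , m′     = matching-through i
      in glue M M′ ,
         glue-regular M M′ (matchings-agree {M} {M′} pm pm′ i m m′) pm pm′

    -- `H₁` leaves `v` by one edge outside `M₁`, with label `j`. Its counterpart at `z` is outside
    -- `M₂`, so malleability offers an `H₂` through it; then both cycles use the same two labels of
    -- the cut.
    glue-extensions :
      ∀ {M₁ M₂} → G.PerfectMatching M₁ → G′.PerfectMatching M₂ →
      (∀ i → M₁ (a-edge i) ≡ M₂ (b-edge i)) →
      ∃ λ H₁ → ∃ λ H₂ → M₁ G.⊆ H₁ × M₂ G′.⊆ H₂ × ⋆.HamiltonianCycle (glue H₁ H₂)
    glue-extensions {M₁} {M₂} pm₁ pm₂ M-agree =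
      H₁ , H₂ , M⊆H₁ , M⊆H₂ ,
      glue-hamiltonian {M₁} {H₁} {M₂} {H₂} pm₁ pm₂ ham₁ ham₂ M⊆H₁ M⊆H₂ H-agree
        (proj₁ m) i∈M₁ (subst T (M-agree (proj₁ m)) i∈M₁)
      where
      m = a-only M₁ pm₁
      i∈M₁ = proj₁ (proj₁ (proj₂ m))
      extension₁ = proj₂ pmh M₁ pm₁
      H₁ = proj₁ extension₁
      ham₁ = proj₁ (proj₂ extension₁)
      M⊆H₁ = proj₂ (proj₂ extension₁)
      N₁-perfect = G.hamiltonian-∖ {M₁} {H₁} pm₁ ham₁ M⊆H₁
      n = a-only (H₁ G.∖ M₁) N₁-perfect
      j = proj₁ n
      j∈N₁ = proj₁ (proj₁ (proj₂ n))
      j∉M₂ : ¬ (b-edge j G′.∈ M₂)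
      j∉M₂ m₂ = T-not {M₁ (a-edge j)} (subst T (sym (M-agree j)) m₂)
                  (proj₂ (Equivalence.to (T-∧ {H₁ (a-edge j)}) j∈N₁))
      extensions₂ = proj₂ (proj₂ (proj₂ malleable)) M₂ pm₂
      hits-j = proj₂ (proj₂ extensions₂) (b-edge j) (b-incident j) j∉M₂
      H₂ = proj₁ extensions₂ (proj₁ hits-j)
      ham₂ = proj₁ (proj₁ (proj₂ extensions₂) (proj₁ hits-j))
      M⊆H₂ = proj₂ (proj₁ (proj₂ extensions₂) (proj₁ hits-j))
      N₂-perfect = G′.hamiltonian-∖ {M₂} {H₂} pm₂ ham₂ M⊆H₂
      -- Each cycle is its matching together with the complementary one. The matchings agree by
      -- assumption; the complements are perfect matchings that both use label `j`.
      H-agree : ∀ i → H₁ (a-edge i) ≡ H₂ (b-edge i)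
      H-agree i = begin
        H₁ (a-edge i)                              ≡⟨ ∨-∖ (M⊆H₁ (a-edge i)) ⟩
        M₁ (a-edge i) ∨ (H₁ G.∖ M₁) (a-edge i)    ≡⟨ cong₂ _∨_ (M-agree i)
          (matchings-agree {H₁ G.∖ M₁} {H₂ G′.∖ M₂} N₁-perfect N₂-perfect
             j j∈N₁ (∖-intro (proj₂ hits-j) j∉M₂) i) ⟩
        M₂ (b-edge i) ∨ (H₂ G′.∖ M₂) (b-edge i)   ≡⟨ ∨-∖ (M⊆H₂ (b-edge i)) ⟨
        H₂ (b-edge i)                              ∎
        where open ≡-Reasoning

    extend⋆ : ∀ M → ⋆.PerfectMatching M → ∃ λ H → ⋆.HamiltonianCycle H × M ⋆.⊆ H
    extend⋆ M pm =
      let H₁ , H₂ , M⊆H₁ , M⊆H₂ , ham = glue-extensions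
            (Restr.perfect₁ covered (λ x _ → pm x))
            (Restr.perfect₂ covered (λ x _ → pm x)) Restr.restrict-agree
      in glue H₁ H₂ , ham , λ
        { (inj₁ e) m        → M⊆H₁ (value e) (subst (T ∘ M) (sym (L.κ-off e)) m)
        ; (inj₂ (inj₁ e)) m → M⊆H₂ (value e) (subst (T ∘ M) (sym (R.κ-off e)) m)
        ; (inj₂ (inj₂ i)) m → M⊆H₁ (a-edge i) (subst (T ∘ M) (sym (L.κ-edge i)) m)
        }
      where
      module Restr = Restriction M (M ∘ L.κ) (M ∘ R.κ) (λ _ → refl) (λ _ → refl)
      covered : ∀ x → ⋆.Covered M x
      covered x = let e , p , _ = ⋆.onlyEdge M (pm x) in e , p

    pmh⋆ : PMH G⋆
    pmh⋆ = perfect⋆ , extend⋆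

-- The invariant is that the current graph is PMH and tight for the vertices not yet treated; each
-- step restores both.
starProducts-PMH : ∀ {k K w Gs z G} → StarProducts {k} K w Gs z G →
                   Tight K w → PMH K → (∀ j → Malleable (Gs j) (z j) 3) → PMH G
starProducts-PMH done _ pmh _ = pmh
starProducts-PMH {K = K} {w} {Gs} (step α β rest) tight pmh malleable =
  starProducts-PMH rest tight⋆ (pmh⋆ pmh) (malleable ∘ suc)
  where open StarStep K w α (Gs zero) β tight (malleable zero)

theorem3p7 : (n : ℕ) → 1 < n →
    (G₀ : Multigraph) → Connected G₀ → PMH G₀ →
    (B : Bipartition G₀ n) →
    (𝓘 : Subset n) →
    ((i : Element 𝓘) → Multigraph.deg G₀ (Bipartition.v B (value i)) ≡ 3) →
    (Gs : Element 𝓘 → Multigraph) →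
    ((i : Element 𝓘) → Connected (Gs i)) →
    ((i : Element 𝓘) → ¬ IsTheta (Gs i)) →
    (z : (i : Element 𝓘) → Multigraph.V (Gs i)) →
    ((i : Element 𝓘) → Malleable (Gs i) (z i) 3) →
    (k : ℕ) (enum : Fin k ↔ Element 𝓘) →
    (G : Multigraph) →
    StarProducts G₀ (listed B enum) (Gs ∘ Inverse.to enum) (λ j → z (Inverse.to enum j)) G →
    PMH G
theorem3p7 n _ G₀ _ pmh B 𝓘 _ Gs _ _ z malleable k enum G products =
  starProducts-PMH products
    (bipartite-tight B (listed B enum) v≢u)
    pmh (malleable ∘ Inverse.to enum)
  where
  -- Listed vertices come from the `inj₂` summand of `classes`, the vertices `u i` from the `inj₁`
  -- summand.
  v≢u : ∀ j i → Injection.to (listed B enum) j ≢ Bipartition.u B i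
  v≢u j i eq with () ← Injection.injective (↔⇒↣ (Bipartition.classes B)) eq
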